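{- Central permutation fails in general: there exist a language $L$, an $L$-algebra $\mathfrak A$ with universe $A$, and elements $a,b,c,d\in A$ such that $a:b\approx_{\mathfrak A}c:d$ holds but $a:c\approx_{\mathfrak A}b:d$ does not hold.
   Context: Let $L$ be a language of algebras: a set of function symbols, each with an arity in $\mathbb N$ (constants are 0-ary function symbols). Fix a countably infinite set $X$ of variables; $T_{L,X}$ is the set of $L$-terms over $X$, and $X(s)$ denotes the set of variables occurring in a term $s$. For an $L$-algebra $\mathfrak A$ with universe $A$, every term $s$ induces a function $s^{\mathfrak A}$, evaluated at assignments of elements of $A$ to variables. An arrow of $\mathfrak A$ is a pair $(a,b)\in A\times A$, written $a\to b$. The generalizations of an arrow $a\to b$ in $\mathfrak A$ are the pairs of arbitrary terms $s\to t$ with $s,t\in T_{L,X}$ such that there is an assignment $\sigma$ of elements of $A$ to the variables in $X(s)\cup X(t)$ with $s^{\mathfrak A}(\sigma)=a$ and $t^{\mathfrak A}(\sigma)=b$; their set is denoted $\uparrow_{\mathfrak A}(a\to b)$. For $L$-algebras $\mathfrak A,\mathfrak B$, an arrow $a\to b$ of $\mathfrak A$ and an arrow $c\to d$ of $\mathfrak B$, set $(a\to b)\uparrow_{(\mathfrak A,\mathfrak B)}(c\to d):=\uparrow_{\mathfrak A}(a\to b)\cap\uparrow_{\mathfrak B}(c\to d)$. A pair of terms $s\to t$ is trivial in $(\mathfrak A,\mathfrak B)$ if it belongs to $\uparrow_{\mathfrak A}(e)$ for every arrow $e$ of $\mathfrak A$ and to $\uparrow_{\mathfrak B}(e')$ for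 every arrow $e'$ of $\mathfrak B$. We write $a\to b\lesssim_{(\mathfrak A,\mathfrak B)}c\to d$ iff either (i) every element of $\uparrow_{\mathfrak A}(a\to b)\cup\uparrow_{\mathfrak B}(c\to d)$ is trivial in $(\mathfrak A,\mathfrak B)$, or (ii) $(a\to b)\uparrow_{(\mathfrak A,\mathfrak B)}(c\to d)$ contains an element not trivial in $(\mathfrak A,\mathfrak B)$ and, for every arrow $c'\to d'$ of $\mathfrak B$, the inclusion $(a\to b)\uparrow_{(\mathfrak A,\mathfrak B)}(c\to d)\subseteq(a\to b)\uparrow_{(\mathfrak A,\mathfrak B)}(c'\to d')$ implies equality of these two sets. Define $a\to b\approx_{(\mathfrak A,\mathfrak B)}c\to d$ iff $a\to b\lesssim_{(\mathfrak A,\mathfrak B)}c\to d$ and $c\to d\lesssim_{(\mathfrak B,\mathfrak A)}a\to b$. For $a,b\in A$ and $c,d\in B$, the similarity-based analogical proportion $a:b\approx_{(\mathfrak A,\mathfrak B)}c:d$ holds iff $a\to b\approx_{(\mathfrak A,\mathfrak B)}c\to d$ and $b\to a\approx_{(\mathfrak A,\mathfrak B)}d\to c$. We write $\approx_{\mathfrak A}$ for $\approx_{(\mathfrak A,\mathfrak A)}$. -}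

module Defs where

open import Data.Nat using (ℕ)
open import Data.Product using (_×_; _,_; ∃-syntax)
open import Data.Sum using (_⊎_)
open import Data.Vec using (Vec; []; _∷_)
open import Level using (0ℓ)
open import Relation.Binary.PropositionalEquality using (_≡_)
open import Relation.Nullary using (¬_)
open import Relation.Unary using (Pred; _∈_; _⊆_; _≐_; _∩_; _∪_)

record Language : Set₁ where
  field
    Symbol : Set
    arity  : Symbol → ℕ

open Language public

-- The fixed countably infinite set of variables.
X : Set
X = ℕ

data Term (L : Language) : Set where
  var : X → Term L
  app : (f : Symbol L) → Vec (Term L) (arity L f) → Term L

record Algebra (L : Language) : Set₁ where
  field
    Carrier : Set
    interp  : (f : Symbol L) → Vec Carrier (arity L f) → Carrier

open Algebra public

module _ {L : Language} where

  infix  5 _⟶_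
  infix  4 ⟨_∣_⟩_≲_ ⟨_∣_⟩_≈→_ ⟨_∣_⟩_∶_≈_∶_ ⟨_⟩_∶_≈_∶_

  data Arrow (𝔄 : Algebra L) : Set where
    _⟶_ : (a b : Carrier 𝔄) → Arrow 𝔄

  TermPair : Set
  TermPair = Term L × Term L

  Assignment : Algebra L → Set
  Assignment 𝔄 = X → Carrier 𝔄

  mutual
    ⟦_⟧ : Term L → (𝔄 : Algebra L) → Assignment 𝔄 → Carrier 𝔄
    ⟦ var x    ⟧ 𝔄 σ = σ x
    ⟦ app f ts ⟧ 𝔄 σ = interp 𝔄 f (⟦ ts ⟧* 𝔄 σ)

    ⟦_⟧* : ∀ {n} → Vec (Term L) n → (𝔄 : Algebra L) → Assignment 𝔄 → Vec (Carrier 𝔄) n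
    ⟦ []     ⟧* 𝔄 σ = []
    ⟦ t ∷ ts ⟧* 𝔄 σ = ⟦ t ⟧ 𝔄 σ ∷ ⟦ ts ⟧* 𝔄 σ

  -- Assignments are total on X rather than defined on X(s) ∪ X(t) only.
  -- Only the values on X(s) ∪ X(t) matter, and a partial assignment can be
  -- extended by the constant a, so the same pairs are generalizations.
  ↑ : (𝔄 : Algebra L) → Arrow 𝔄 → Pred TermPair 0ℓ
  ↑ 𝔄 (a ⟶ b) (s , t) = ∃[ σ ] (⟦ s ⟧ 𝔄 σ ≡ a × ⟦ t ⟧ 𝔄 σ ≡ b)

  ↑₂ : (𝔄 𝔅 : Algebra L) → Arrow 𝔄 → Arrow 𝔅 → Pred TermPair 0ℓ
  ↑₂ 𝔄 𝔅 e e′ = ↑ 𝔄 e ∩ ↑ 𝔅 e′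

  Trivial : (𝔄 𝔅 : Algebra L) → Pred TermPair 0ℓ
  Trivial 𝔄 𝔅 p = (∀ (e : Arrow 𝔄) → p ∈ ↑ 𝔄 e) × (∀ (e′ : Arrow 𝔅) → p ∈ ↑ 𝔅 e′)

  ⟨_∣_⟩_≲_ : (𝔄 𝔅 : Algebra L) → Arrow 𝔄 → Arrow 𝔅 → Set
  ⟨ 𝔄 ∣ 𝔅 ⟩ e ≲ e′ =
    ((↑ 𝔄 e ∪ ↑ 𝔅 e′) ⊆ Trivial 𝔄 𝔅)
    ⊎
    ((∃[ p ] (p ∈ ↑₂ 𝔄 𝔅 e e′ × ¬ (p ∈ Trivial 𝔄 𝔅)))
     × (∀ (e″ : Arrow 𝔅) → ↑₂ 𝔄 𝔅 e e′ ⊆ ↑₂ 𝔄 𝔅 e e″ → ↑₂ 𝔄 𝔅 e e′ ≐ ↑₂ 𝔄 𝔅 e e″))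

  ⟨_∣_⟩_≈→_ : (𝔄 𝔅 : Algebra L) → Arrow 𝔄 → Arrow 𝔅 → Set
  ⟨ 𝔄 ∣ 𝔅 ⟩ e ≈→ e′ = (⟨ 𝔄 ∣ 𝔅 ⟩ e ≲ e′) × (⟨ 𝔅 ∣ 𝔄 ⟩ e′ ≲ e)

  ⟨_∣_⟩_∶_≈_∶_ : (𝔄 𝔅 : Algebra L) → Carrier 𝔄 → Carrier 𝔄 → Carrier 𝔅 → Carrier 𝔅 → Set
  ⟨ 𝔄 ∣ 𝔅 ⟩ a ∶ b ≈ c ∶ d = (⟨ 𝔄 ∣ 𝔅 ⟩ (a ⟶ b) ≈→ (c ⟶ d)) × (⟨ 𝔄 ∣ 𝔅 ⟩ (b ⟶ a) ≈→ (d ⟶ c))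

  ⟨_⟩_∶_≈_∶_ : (𝔄 : Algebra L) → (a b c d : Carrier 𝔄) → Set
  ⟨ 𝔄 ⟩ a ∶ b ≈ c ∶ d = ⟨ 𝔄 ∣ 𝔄 ⟩ a ∶ b ≈ c ∶ d

{-# OPTIONS --safe #-}
-- Over the empty language the only term pairs are x → y and x → x. The former
-- are trivial, the latter generalize exactly the arrows a → a. So any two
-- arrows with distinct endpoints are similar, by (i), while a → a is
-- similar to no arrow with distinct endpoints. On a three-element set this
-- gives 0 : 1 ≈ 0 : 2 but not 0 : 0 ≈ 1 : 2.
module Submission where

open import Defs
open import Data.Bool using (if_then_else_)
open import Data.Empty using (⊥)
open import Data.Fin using (Fin; zero; suc)
open import Data.Nat using (_≟_)
open import Data.Product using (Σ-syntax; _×_; _,_; proj₁)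
open import Data.Sum using (inj₁; inj₂; [_,_])
open import Relation.Binary.PropositionalEquality using (_≢_; refl; sym; trans; cong)
open import Relation.Nullary using (¬_; does)
open import Relation.Nullary.Decidable using (dec-true; dec-false)
open import Relation.Unary using (_∈_; _⊆_)

emptyLanguage : Language
emptyLanguage = record { Symbol = ⊥ ; arity = λ () }

bareSet : Set → Algebra emptyLanguage
bareSet A = record { Carrier = A ; interp = λ () }

module _ {A : Set} where

  private
    𝔄 : Algebra emptyLanguage
    𝔄 = bareSet A

  -- Distinct variables take values independently: send `x` to `c` and every other variable to `d`.
  distinct-vars-generalize : ∀ {x y} → x ≢ y → (e : Arrow 𝔄) → (var x , var y) ∈ ↑ 𝔄 e
  distinct-vars-generalize {x} {y} x≢y (c ⟶ d) =
    (λ z → if does (z ≟ x) then c else d) ,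
    cong (if_then c else d) (dec-true (x ≟ x) refl) ,
    cong (if_then c else d) (dec-false (y ≟ x) (λ y≡x → x≢y (sym y≡x)))

  -- Every term is a variable, and one variable cannot take two values under a single assignment.
  ↑-≢⊆Trivial : ∀ {a b : A} → a ≢ b → ↑ 𝔄 (a ⟶ b) ⊆ Trivial 𝔄 𝔄
  ↑-≢⊆Trivial a≢b {var x , var y} (σ , σx≡a , σy≡b) =
    distinct-vars-generalize x≢y , distinct-vars-generalize x≢y
    where
    x≢y : x ≢ y
    x≢y x≡y = a≢b (trans (sym σx≡a) (trans (cong σ x≡y) σy≡b))

  ≢⇒≲ : ∀ {a b c d : A} → a ≢ b → c ≢ d → ⟨ 𝔄 ∣ 𝔄 ⟩ (a ⟶ b) ≲ (c ⟶ d)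
  ≢⇒≲ a≢b c≢d = inj₁ [ ↑-≢⊆Trivial a≢b , ↑-≢⊆Trivial c≢d ]

  ≢⇒∶≈∶ : ∀ {a b c d : A} → a ≢ b → c ≢ d → ⟨ 𝔄 ⟩ a ∶ b ≈ c ∶ d
  ≢⇒∶≈∶ {a} {b} {c} {d} a≢b c≢d =
    (≢⇒≲ a≢b c≢d , ≢⇒≲ c≢d a≢b) , (≢⇒≲ b≢a d≢c , ≢⇒≲ d≢c b≢a)
    where
    b≢a : b ≢ a
    b≢a b≡a = a≢b (sym b≡a)

    d≢c : d ≢ c
    d≢c d≡c = c≢d (sym d≡c)

  loop≴≢ : ∀ {a c d : A} → c ≢ d → ¬ (⟨ 𝔄 ∣ 𝔄 ⟩ (a ⟶ a) ≲ (c ⟶ d))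
  loop≴≢ {a} {c} {d} c≢d (inj₁ all-trivial)
    -- Clause (i) would make x → x trivial, hence a generalization of `c ⟶ d`, forcing `c ≡ d`.
    with all-trivial {var 0 , var 0} (inj₁ ((λ _ → a) , refl , refl))
  ... | x⟶x-generalizes , _ with x⟶x-generalizes (c ⟶ d)
  ...   | _ , σ0≡c , σ0≡d = c≢d (trans (sym σ0≡c) σ0≡d)
  -- Clause (ii) needs a nontrivial common generalization, but `c ⟶ d` has only trivial ones.
  loop≴≢ c≢d (inj₂ ((p , (_ , p∈↑cd) , nontrivial) , _)) =
    nontrivial (↑-≢⊆Trivial c≢d {p} p∈↑cd)

theorem3 : Σ[ L ∈ Language ] Σ[ 𝔄 ∈ Algebra L ]
    Σ[ a ∈ Carrier 𝔄 ] Σ[ b ∈ Carrier 𝔄 ] Σ[ c ∈ Carrier 𝔄 ] Σ[ d ∈ Carrier 𝔄 ]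
    ((⟨ 𝔄 ⟩ a ∶ b ≈ c ∶ d) × ¬ (⟨ 𝔄 ⟩ a ∶ c ≈ b ∶ d))
theorem3 =
  emptyLanguage , bareSet (Fin 3) ,
  -- With `a` and `c` equal, permuting turns the first arrow into a loop; `b ≢ d` keeps the second
  -- from being one.
  zero , suc zero , zero , suc (suc zero) ,
  ≢⇒∶≈∶ (λ ()) (λ ()) ,
  λ 0∶0≈1∶2 → loop≴≢ (λ ()) (proj₁ (proj₁ 0∶0≈1∶2))
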